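{- Let $\varphi$ be a satisfiable LTL formula over the variables in $\mathcal{I}\cup\mathcal{O}$, given as input to the algorithm $\mathcal{NDC}$ described in the context. Then (whatever the choices of variables made by the algorithm and whatever falsifying traces are returned by the validity checker) each iteration of the main loop of $\mathcal{NDC}$ computes a set $V\subseteq\mathcal{O}$ that is independent in $\varphi$ and has no non-empty proper subset $U\subsetneq V$ that is independent in $\varphi$.
   Context: Propositional variables are split into two disjoint sets: $\mathcal{I}$ (controlled by the environment) and the finite set $\mathcal{O}$ (controlled by the system). $\mathcal{O}'=\{y'\mid y\in\mathcal{O}\}$ is a set of fresh primed copies of the variables in $\mathcal{O}$. LTL formulae are built from variables with $\neg,\wedge$, $\bigcirc$ (next), $\mathcal{U}$ (until) and the usual abbreviations $\mathbf{F}$ (the constant false), $\vee,\to,\leftrightarrow$, $\Diamond$ (eventually), $\Box$ (always). They are interpreted with the standard semantics, evaluated at position $0$, over traces, i.e. infinite sequences $\sigma=\sigma_0,\sigma_1,\dots$ of sets of variables ($\sigma_i$ is the set of variables true at time $i$). A formula is valid if all traces (over the variables $\mathcal{I}\cup\mathcal{O}\cup\mathcal{O}'$) satisfy it. For $V\subseteq\mathcal{O}$ put $\overline V=\mathcal{O}\setminus V$. The projection formula $\varphi_V$ is obtained from $\varphi$ by replacing every variable $w\in\overline V$ by its primed copy $w'$ (variables in $\mathcal{I}\cup V$ are unchanged). Independence: $V\subseteq\mathcal{O}$ is independent in $\varphi$ iff the formula $(\varphi_V\wedge\varphi_{\overline V})\to\varphi$ is valid. CheckValidity$(\Phi)$ returns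 $(\mathit{true},\cdot)$ if the LTL formula $\Phi$ is valid, and otherwise returns $(\mathit{false},\sigma)$, where $\sigma$ is some (arbitrary) trace over $\mathcal{I}\cup\mathcal{O}\cup\mathcal{O}'$ with $\sigma\not\models\Phi$. Algorithm $\mathcal{NDC}$ (input: a satisfiable LTL formula $\varphi$ over $\mathcal{I}\cup\mathcal{O}$; output: $\mathit{clusters}$): - Set $\mathit{clusters}:=\emptyset$, $R:=\mathcal{O}$. - Main loop: while $R\neq\emptyset$: choose any $x\in R$; set $V:=\{x\}$; repeat the following inner loop until $\mathit{passed}$ is true: [$\overline V:=\mathcal{O}\setminus V$; $(\mathit{passed},\sigma):=$ CheckValidity$((\varphi_V\wedge\varphi_{\overline V})\to\varphi)$; if not $\mathit{passed}$, then $D:=$ NewParseTrace$(\varphi,V,\sigma)$ and $V:=V\cup D$]. Then set $\mathit{clusters}:=\mathit{clusters}\cup\{V\}$ and $R:=\mathcal{O}\setminus\bigcup_{S\in\mathit{clusters}}S$. This final $V$ is the set computed by the iteration of the main loop. - Return $\mathit{clusters}$. NewParseTrace$(\varphi,V,\sigma)$, where $\sigma\models\varphi_V\wedge\varphi_{\overline V}\wedge\neg\varphi$: - Set $\mathit{passed}:=\mathit{false}$, $\mathit{binds}:=\mathbf{F}$, $\tau:=\sigma$. - While not $\mathit{passed}$: let $Z:=\{z\in\overline V : \text{for some } i\ge 0,\ (z\in\tau_i \text{ iff } z'\notin\tau_i)\}$; let $z$ be any variable in $Z$; set $\mathit{binds}:=\mathit{binds}\vee\Diamond(z\leftrightarrow\neg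 z')$; set $(\mathit{passed},\tau):=$ CheckValidity$(\mathit{binds}\vee((\varphi_V\wedge\varphi_{\overline V})\to\varphi))$. - Return $\{z\}$ (the last variable chosen). -}

module Defs where

open import Data.Bool.Base using (Bool; T; if_then_else_)
open import Data.Empty using (⊥)
open import Data.Fin.Base using (Fin)
open import Data.Fin.Subset using (Subset; _∈_; _⊂_; _∪_; ⁅_⁆; ∁; ⋃; ⊤; Nonempty)
open import Data.Fin.Subset.Properties using (_∈?_)
open import Data.List.Base using (List; []; _∷_)
open import Data.Maybe.Base using (Maybe; just; nothing)
open import Data.Nat.Base using (ℕ; suc; _≤_; _<_)
open import Data.Product.Base using (∃-syntax; _×_)
open import Data.Sum.Base using (_⊎_; inj₁; inj₂)
open import Function.Base using (flip)
open import Function.Bundles using (_⇔_)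
open import Induction.WellFounded using (Acc)
open import Relation.Binary.Construct.Closure.ReflexiveTransitive using (Star)
open import Relation.Nullary.Decidable.Core using (does)
open import Relation.Nullary.Negation.Core using (¬_)

infix  9 ~_ ○_ ◇_
infixr 8 _𝓤_
infixr 7 _∧_
infixr 6 _∨_
infixr 5 _⟶_
infix  5 _⟷_

-- 𝐅 is primitive because it cannot be an abbreviation such as p ∧ ~ p
-- when there are no variables.
data Formula (A : Set) : Set where
  var : A → Formula A
  𝐅   : Formula A
  ~_  : Formula A → Formula A
  _∧_ : Formula A → Formula A → Formula A
  ○_  : Formula A → Formula A
  _𝓤_ : Formula A → Formula A → Formula A

_∨_ _⟶_ _⟷_ : {A : Set} → Formula A → Formula A → Formula A
a ∨ b = ~ (~ a ∧ ~ b)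
a ⟶ b = ~ (a ∧ ~ b)
a ⟷ b = (a ⟶ b) ∧ (b ⟶ a)

◇_ : {A : Set} → Formula A → Formula A
◇ a = ~ 𝐅 𝓤 a

rename : {A B : Set} → (A → B) → Formula A → Formula B
rename f (var a) = var (f a)
rename f 𝐅       = 𝐅
rename f (~ a)   = ~ rename f a
rename f (a ∧ b) = rename f a ∧ rename f b
rename f (○ a)   = ○ rename f a
rename f (a 𝓤 b) = rename f a 𝓤 rename f b

-- A set of variables is given by its characteristic function: classically
-- no restriction, and constructively it makes variables two-valued.
Trace : Set → Set
Trace A = ℕ → A → Bool

infix 4 _,_⊨_ _⊨_ _⊭_

_,_⊨_ : {A : Set} → Trace A → ℕ → Formula A → Set
σ , i ⊨ var a = T (σ i a)
σ , i ⊨ 𝐅     = ⊥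
σ , i ⊨ ~ a   = ¬ (σ , i ⊨ a)
σ , i ⊨ a ∧ b = (σ , i ⊨ a) × (σ , i ⊨ b)
σ , i ⊨ ○ a   = σ , suc i ⊨ a
σ , i ⊨ a 𝓤 b =
  ∃[ k ] i ≤ k × (σ , k ⊨ b) × (∀ j → i ≤ j → j < k → σ , j ⊨ a)

_⊨_ _⊭_ : {A : Set} → Trace A → Formula A → Set
σ ⊨ a = σ , 0 ⊨ a
σ ⊭ a = ¬ (σ ⊨ a)

Valid Satisfiable : {A : Set} → Formula A → Set
Valid       {A} a = (σ : Trace A) → σ ⊨ a
Satisfiable {A} a = ∃[ σ ] σ ⊨ a

-- The variables in 𝓘 ∪ 𝓞, where 𝓞 = Fin n, and those in 𝓘 ∪ 𝓞 ∪ 𝓞′.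
Var : Set → ℕ → Set
Var I n = I ⊎ Fin n

data Var′ (I : Set) (n : ℕ) : Set where
  inp  : I → Var′ I n
  out  : Fin n → Var′ I n
  out′ : Fin n → Var′ I n

module _ {I : Set} {n : ℕ} where

  embedVar : Var I n → Var′ I n
  embedVar (inj₁ i) = inp i
  embedVar (inj₂ w) = out w

  projectVar : Subset n → Var I n → Var′ I n
  projectVar V (inj₁ i) = inp i
  projectVar V (inj₂ w) = if does (w ∈? V) then out w else out′ w

  embed : Formula (Var I n) → Formula (Var′ I n)
  embed = rename embedVar

  project : Formula (Var I n) → Subset n → Formula (Var′ I n)
  project φ V = rename (projectVar V) φ

  independence : Formula (Var I n) → Subset n → Formula (Var′ I n)
  independence φ V = (project φ V ∧ project φ (∁ V)) ⟶ embed φ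

  Independent : Formula (Var I n) → Subset n → Set
  Independent φ V = Valid (independence φ V)

  Minimal : Formula (Var I n) → Subset n → Set
  Minimal φ V = ¬ (∃[ U ] Nonempty U × U ⊂ V × Independent φ U)

-- CheckValidity Φ r: the validity checker may return r on Φ, where nothing
-- stands for (true , ·) and just σ for (false , σ).
data CheckValidity {A : Set} (Φ : Formula A) : Maybe (Trace A) → Set where
  passed : Valid Φ → CheckValidity Φ nothing
  failed : ∀ {σ} → σ ⊭ Φ → CheckValidity Φ (just σ)

module _ {I : Set} {n : ℕ} where

  -- z ∈ Z, for the set Z computed from V and τ in NewParseTrace.
  Differs : Subset n → Trace (Var′ I n) → Fin n → Set
  Differs V τ z =
    z ∈ ∁ V × ∃[ i ] (T (τ i (out z)) ⇔ (¬ T (τ i (out′ z))))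

  addBind : Formula (Var′ I n) → Fin n → Formula (Var′ I n)
  addBind binds z = binds ∨ ◇ (var (out z) ⟷ ~ var (out′ z))

-- Control states of one iteration of the main loop of NDC.
data State (I : Set) (n : ℕ) : Set where
  -- about to choose x ∈ R
  start    : (R : Subset n) → State I n
  -- at the head of the inner loop
  refine   : (V : Subset n) → State I n
  -- at the head of the loop of NewParseTrace
  parse    : (V : Subset n) (binds : Formula (Var′ I n))
             (τ : Trace (Var′ I n)) → State I n
  -- inner loop left, with final set V
  computed : (V : Subset n) → State I n

module _ {I : Set} {n : ℕ} where

  data Step (φ : Formula (Var I n)) : State I n → State I n → Set where
    choose :
      ∀ {R x} → x ∈ R →
      Step φ (start R) (refine ⁅ x ⁆)
    inner-passed :
      ∀ {V} → CheckValidity (independence φ V) nothing →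
      Step φ (refine V) (computed V)
    inner-failed :
      ∀ {V σ} → CheckValidity (independence φ V) (just σ) →
      Step φ (refine V) (parse V 𝐅 σ)
    parse-passed :
      ∀ {V binds τ z} → Differs V τ z →
      CheckValidity (addBind binds z ∨ independence φ V) nothing →
      Step φ (parse V binds τ) (refine (V ∪ ⁅ z ⁆))
    parse-failed :
      ∀ {V binds τ z τ′} → Differs V τ z →
      CheckValidity (addBind binds z ∨ independence φ V) (just τ′) →
      Step φ (parse V binds τ) (parse V (addBind binds z) τ′)

  Steps : Formula (Var I n) → State I n → State I n → Set
  Steps φ = Star (Step φ)

  -- Every sequence of steps from s is finite.
  Terminates : Formula (Var I n) → State I n → Set
  Terminates φ = Acc (flip (Step φ))

  -- LoopHead φ clusters R: some run of NDC on φ reaches the test R ≠ ∅ with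
  -- these values. The set clusters is represented by a list of its elements.
  data LoopHead (φ : Formula (Var I n)) : List (Subset n) → Subset n → Set where
    init    : LoopHead φ [] ⊤
    iterate :
      ∀ {clusters R V} → LoopHead φ clusters R → Nonempty R →
      Steps φ (start R) (computed V) →
      LoopHead φ (V ∷ clusters) (∁ (⋃ (V ∷ clusters)))

{-# OPTIONS --safe #-}

-- A trace over 𝓘 ∪ 𝓞 ∪ 𝓞′ is a pair (s , t) of traces over 𝓘 ∪ 𝓞 with equal
-- inputs, and V is independent iff, for all models s and t of φ with equal
-- inputs, the trace that follows s on V and t off V is a model.  Hence
-- independent sets are closed under complement and intersection.  The inner
-- loop keeps V inside every independent W ∋ x: if parsing ends with z while
-- some independent W ⊇ V omits z, then replacing t by s off W turns the last
-- falsifying trace into one that also agrees on z, although none exists.  So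
-- the final V is the least independent set containing x; for an independent
-- U ⊂ V, one of U and V ∩ ∁ U contains x, hence includes V, and so U = ∅.
module Submission where

open import Defs
open import Data.Bool.Base using (Bool; true; false; not; T; if_then_else_)
import Data.Bool.Base as Bool
open import Data.Empty using (⊥-elim)
open import Data.Fin.Base using (Fin)
open import Data.Fin.Subset using (Subset; Nonempty; _∈_; _∉_; _⊆_; _⊂_; _⊃_; _∩_; _∪_; ⁅_⁆; ∁; ⊥)
open import Data.Fin.Subset.Induction using (⊃-wellFounded)
open import Data.Fin.Subset.Properties using (_∈?_; ∉⊥; x∈⁅x⁆; x∈⁅y⁆⇒x≡y; x∈p⇒x∉∁p; x∈∁p⇒x∉p; x∉p⇒x∈∁p; p⊆p∪q; q⊆p∪q; x∈p∪q⁻; x∈p∩q⁺; x∈p∩q⁻; ∩⇔×)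
open import Data.List.Base using (List)
open import Data.Nat.Base using (ℕ; z≤n)
open import Data.Product.Base using (_×_; _,_; ∃-syntax; proj₁; proj₂)
open import Data.Sum.Base using (inj₁; inj₂; [_,_]′)
open import Function.Base using (_∘_; const; id)
open import Function.Bundles using (_⇔_; mk⇔; Equivalence)
open import Induction.WellFounded using (Acc; acc)
open import Relation.Binary.Construct.Closure.ReflexiveTransitive using (ε; _◅_)
open import Relation.Binary.PropositionalEquality.Core using (_≡_; refl; sym; cong; subst; _≗_)
open import Relation.Binary.Rewriting using (IsNormalForm)
open import Relation.Nullary.Decidable using (yes; no; does; ¬?; _×-dec_; does-⇔; dec-false; decidable-stable)
open import Relation.Nullary.Negation using (¬_; contradiction)

open Equivalence using (to; from)

-- Satisfaction of renamed formulas and of disjunctions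

module _ {A B C : Set} {f : A → B} {g : A → C} where

  -- Negation exchanges the two directions, so both implications go by one simultaneous induction.
  rename-transport : {σ : Trace B} {ρ : Trace C} → (∀ j a → σ j (f a) ≡ ρ j (g a)) →
                     ∀ φ {i} → σ , i ⊨ rename f φ → ρ , i ⊨ rename g φ
  rename-transport′ : {σ : Trace B} {ρ : Trace C} → (∀ j a → σ j (f a) ≡ ρ j (g a)) →
                      ∀ φ {i} → ρ , i ⊨ rename g φ → σ , i ⊨ rename f φ

  rename-transport eq (var a) {i} h = subst T (eq i a) h
  rename-transport eq (~ φ) h = h ∘ rename-transport′ eq φ
  rename-transport eq (φ ∧ ψ) (h , k) = rename-transport eq φ h , rename-transport eq ψ k
  rename-transport eq (○ φ) h = rename-transport eq φ h
  rename-transport eq (φ 𝓤 ψ) (k , i≤k , h , before) =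
    k , i≤k , rename-transport eq ψ h , λ j i≤j j<k → rename-transport eq φ (before j i≤j j<k)

  rename-transport′ eq (var a) {i} h = subst T (sym (eq i a)) h
  rename-transport′ eq (~ φ) h = h ∘ rename-transport eq φ
  rename-transport′ eq (φ ∧ ψ) (h , k) = rename-transport′ eq φ h , rename-transport′ eq ψ k
  rename-transport′ eq (○ φ) h = rename-transport′ eq φ h
  rename-transport′ eq (φ 𝓤 ψ) (k , i≤k , h , before) =
    k , i≤k , rename-transport′ eq ψ h , λ j i≤j j<k → rename-transport′ eq φ (before j i≤j j<k)

module _ {A : Set} (a b : Formula A) {σ : Trace A} where

  ⊭-∨⁺ : σ ⊭ a → σ ⊭ b → σ ⊭ a ∨ b
  ⊭-∨⁺ ¬a ¬b a∨b = a∨b (¬a , ¬b)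

  ⊭-∨⁻ˡ : σ ⊭ a ∨ b → σ ⊭ a
  ⊭-∨⁻ˡ ¬a∨b h = ¬a∨b λ (¬a , _) → ¬a h

  ⊭-∨⁻ʳ : σ ⊭ a ∨ b → σ ⊭ b
  ⊭-∨⁻ʳ ¬a∨b h = ¬a∨b λ (_ , ¬b) → ¬b h

-- The algorithm calls the checker on negations only.  Such formulas are stable,
-- so that progress needs no excluded middle.
¬¬CheckValidity-~ : {A : Set} (a : Formula A) → ¬ (∀ r → ¬ CheckValidity (~ a) r)
¬¬CheckValidity-~ a none =
  none _ (passed λ σ h → none _ (failed {σ = σ} λ ¬h → ¬h h))

χ : {n : ℕ} → Subset n → Fin n → Bool
χ V w = does (w ∈? V)

module _ {n : ℕ} where

  χ-∁ : (V : Subset n) → χ (∁ V) ≗ not ∘ χ V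
  χ-∁ V w = does-⇔ (mk⇔ x∈∁p⇒x∉p x∉p⇒x∈∁p) (w ∈? ∁ V) (¬? (w ∈? V))

  χ-∩ : (V W : Subset n) → ∀ w → χ (V ∩ W) w ≡ χ V w Bool.∧ χ W w
  χ-∩ V W w = does-⇔ ∩⇔× (w ∈? V ∩ W) ((w ∈? V) ×-dec (w ∈? W))

  p⊂p∪⁅x⁆ : {p : Subset n} {x : Fin n} → x ∉ p → p ⊂ p ∪ ⁅ x ⁆
  p⊂p∪⁅x⁆ {p} {x} x∉p = p⊆p∪q ⁅ x ⁆ , x , q⊆p∪q p ⁅ x ⁆ (x∈⁅x⁆ x) , x∉p

-- Mixing the two components of a trace

module _ {I : Set} {n : ℕ} where

  copy : Bool → Fin n → Var′ I n
  copy b w = if b then out w else out′ w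

  -- With the trace seen as a pair (s , t), a formula renamed by `pick c` speaks of the mix that
  -- follows s where `c` is true and t elsewhere. Boolean functions instead of subsets let mixes of
  -- mixes compute by case distinction.
  pick : (Fin n → Bool) → Var I n → Var′ I n
  pick c (inj₁ i) = inp i
  pick c (inj₂ w) = copy (c w) w

  _[_,_] : Trace (Var′ I n) → (c d : Fin n → Bool) → Trace (Var′ I n)
  (τ [ c , d ]) j (inp i)  = τ j (inp i)
  (τ [ c , d ]) j (out w)  = τ j (copy (c w) w)
  (τ [ c , d ]) j (out′ w) = τ j (copy (d w) w)

  -- A common form of two conditions: falsity of the bind for `z` and, for `z` off `V`, failure of
  -- `Differs V τ z`.
  Agree : Trace (Var′ I n) → Fin n → Set
  Agree τ z = ∀ i → τ i (out z) ≡ τ i (out′ z)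

  module _ (φ : Formula (Var I n)) {τ : Trace (Var′ I n)} where

    pick-cong : ∀ {c d} → c ≗ d → τ ⊨ rename (pick c) φ → τ ⊨ rename (pick d) φ
    pick-cong c≗d = rename-transport eq φ
      where
      eq : ∀ j a → τ j (pick _ a) ≡ τ j (pick _ a)
      eq j (inj₁ i) = refl
      eq j (inj₂ w) = cong (λ b → τ j (copy b w)) (c≗d w)

    project⇒pick : ∀ {V} → τ ⊨ project φ V → τ ⊨ rename (pick (χ V)) φ
    project⇒pick = rename-transport (λ { j (inj₁ _) → refl ; j (inj₂ _) → refl }) φ

    pick⇒project : ∀ {V} → τ ⊨ rename (pick (χ V)) φ → τ ⊨ project φ V
    pick⇒project = rename-transport (λ { j (inj₁ _) → refl ; j (inj₂ _) → refl }) φ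

    embed⇒pick : τ ⊨ embed φ → τ ⊨ rename (pick (const true)) φ
    embed⇒pick = rename-transport (λ { j (inj₁ _) → refl ; j (inj₂ _) → refl }) φ

    pick⇒embed : τ ⊨ rename (pick (const true)) φ → τ ⊨ embed φ
    pick⇒embed = rename-transport (λ { j (inj₁ _) → refl ; j (inj₂ _) → refl }) φ

    project-∁⇒pick : ∀ {V} → τ ⊨ project φ (∁ V) → τ ⊨ rename (pick (not ∘ χ V)) φ
    project-∁⇒pick {V} = pick-cong (χ-∁ V) ∘ project⇒pick

    pick⇒project-∁ : ∀ {V} → τ ⊨ rename (pick (not ∘ χ V)) φ → τ ⊨ project φ (∁ V)
    pick⇒project-∁ {V} = pick⇒project ∘ pick-cong (sym ∘ χ-∁ V)

    module _ {c d e : Fin n → Bool} where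

      private
        eq : ∀ j a → τ j (pick (λ w → if e w then c w else d w) a) ≡ (τ [ c , d ]) j (pick e a)
        eq j (inj₁ i) = refl
        eq j (inj₂ w) with e w
        ... | true  = refl
        ... | false = refl

      pick-[,]⁺ : τ ⊨ rename (pick λ w → if e w then c w else d w) φ →
                  τ [ c , d ] ⊨ rename (pick e) φ
      pick-[,]⁺ = rename-transport eq φ

      pick-[,]⁻ : τ [ c , d ] ⊨ rename (pick e) φ →
                  τ ⊨ rename (pick λ w → if e w then c w else d w) φ
      pick-[,]⁻ = rename-transport′ eq φ

    -- Independence is applied to the pair `ρ` of the desired mix and the opposite one: projecting
    -- it along `W` gives back the mix for `c`, along `∁ W` the one for `d`. The double negation
    -- comes from the encoding of `⟶`.
    independent-mix : ∀ {W} {c d : Fin n → Bool} → Independent φ W →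
                      τ ⊨ rename (pick c) φ → τ ⊨ rename (pick d) φ →
                      ¬ ¬ (τ ⊨ rename (pick λ w → if χ W w then c w else d w) φ)
    independent-mix {W} {c} {d} indep hc hd ¬mix =
      indep ρ
        ( ( rename-transport eq φ hc , rename-transport eq∁ φ hd )
        , λ h → ¬mix (rename-transport eq⊤ φ h) )
      where
      mixed : Fin n → Bool
      mixed w = if χ W w then c w else d w

      ρ : Trace (Var′ I n)
      ρ = τ [ mixed , (λ w → if χ W w then d w else c w) ]

      eq : ∀ j a → τ j (pick c a) ≡ ρ j (projectVar W a)
      eq j (inj₁ i) = refl
      eq j (inj₂ w) with χ W w in p
      ... | true  rewrite p = refl
      ... | false rewrite p = refl

      eq∁ : ∀ j a → τ j (pick d a) ≡ ρ j (projectVar (∁ W) a)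
      eq∁ j (inj₁ i) = refl
      eq∁ j (inj₂ w) rewrite χ-∁ W w with χ W w in p
      ... | true  rewrite p = refl
      ... | false rewrite p = refl

      eq⊤ : ∀ j a → ρ j (embedVar a) ≡ τ j (pick mixed a)
      eq⊤ j (inj₁ i) = refl
      eq⊤ j (inj₂ w) = refl

  -- Closure properties of independent sets

  module _ (φ : Formula (Var I n)) where

    independent-∁ : ∀ {V} → Independent φ V → Independent φ (∁ V)
    independent-∁ {V} indep τ ((h∁ , h∁∁) , ¬h) =
      independent-mix φ indep (project-∁⇒pick φ h∁∁) (project⇒pick φ h∁)
        (¬h ∘ pick⇒embed φ ∘ pick-cong φ eq)
      where
      eq : ∀ w → (if χ V w then not (χ (∁ V) w) else χ (∁ V) w) ≡ true
      eq w rewrite χ-∁ V w with χ V w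
      ... | true  = refl
      ... | false = refl

    -- On the blocks V ∩ W, V ∖ W, W ∖ V and the rest, the given models read
    -- sttt and tsss; they mix to stss along V and to ssts along W, and these
    -- two mix to ssss along W.
    independent-∩ : ∀ {V W} → Independent φ V → Independent φ W → Independent φ (V ∩ W)
    independent-∩ {V} {W} indepV indepW τ ((h , h∁) , ¬h) =
      independent-mix φ indepV h₁ h₂ λ h₃ →
      independent-mix φ indepW h₁ h₂ λ h₄ →
      independent-mix φ indepW h₃ h₄ (¬h ∘ pick⇒embed φ ∘ pick-cong φ eq)
      where
      h₁ = project⇒pick φ h
      h₂ = project-∁⇒pick φ h∁

      eq : ∀ w → let s = χ (V ∩ W) w in
           (if χ W w then (if χ V w then s else not s) else (if χ W w then s else not s)) ≡ true
      eq w rewrite χ-∩ V W w with χ V w | χ W w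
      ... | true  | true  = refl
      ... | true  | false = refl
      ... | false | true  = refl
      ... | false | false = refl

  -- Disagreement between a variable and its primed copy

  module _ (τ : Trace (Var′ I n)) (z : Fin n) where

    agree⇒⊭◇ : Agree τ z → τ ⊭ ◇ (var (out z) ⟷ ~ var (out′ z))
    agree⇒⊭◇ agree (k , _ , (h , h′) , _) with τ k (out z) | τ k (out′ z) | agree k
    ... | true  | _ | refl = h (_ , λ ¬t → ¬t _)
    ... | false | _ | refl = h′ (id , id)

    ⊭◇⇒agree : τ ⊭ ◇ (var (out z) ⟷ ~ var (out′ z)) → Agree τ z
    ⊭◇⇒agree ¬◇ k with τ k (out z) in p | τ k (out′ z) in q
    ... | true  | true  = refl
    ... | false | false = refl
    ... | true  | false = ⊥-elim (¬◇ (k , z≤n , differ , λ _ _ _ ()))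
      where
      differ : τ , k ⊨ var (out z) ⟷ ~ var (out′ z)
      differ rewrite p | q = (λ (_ , ¬¬f) → ¬¬f id) , λ (_ , ¬t) → ¬t _
    ... | false | true  = ⊥-elim (¬◇ (k , z≤n , differ , λ _ _ _ ()))
      where
      differ : τ , k ⊨ var (out z) ⟷ ~ var (out′ z)
      differ rewrite p | q = (λ ()) , λ (¬t , _) → ¬t _

    agree⇒¬Differs : ∀ {V} → Agree τ z → ¬ Differs V τ z
    agree⇒¬Differs agree (_ , k , t⇔f) with τ k (out z) | τ k (out′ z) | agree k
    ... | true  | _ | refl = to t⇔f _ _
    ... | false | _ | refl = from t⇔f id

    ¬Differs⇒agree : ∀ {V} → z ∉ V → ¬ Differs V τ z → Agree τ z
    ¬Differs⇒agree z∉V ¬differs k with τ k (out z) in p | τ k (out′ z) in q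
    ... | true  | true  = refl
    ... | false | false = refl
    ... | true  | false = ⊥-elim (¬differs (x∉p⇒x∈∁p z∉V , k , differ))
      where
      differ : T (τ k (out z)) ⇔ (¬ T (τ k (out′ z)))
      differ rewrite p | q = mk⇔ (λ _ → id) _
    ... | false | true  = ⊥-elim (¬differs (x∉p⇒x∈∁p z∉V , k , differ))
      where
      differ : T (τ k (out z)) ⇔ (¬ T (τ k (out′ z)))
      differ rewrite p | q = mk⇔ (λ ()) (λ ¬t → ¬t _)

  -- If the copies agreed everywhere off `V`, then `project φ V` and `embed φ` would say the same of
  -- `τ`. So Z is never empty when a variable is to be chosen from it.
  ¬¬∃Differs : ∀ (φ : Formula (Var I n)) {V τ} → τ ⊭ independence φ V → ¬ ¬ (∃[ z ] Differs V τ z)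
  ¬¬∃Differs φ {V} {τ} ¬indep none =
    ¬indep λ ((h , _) , ¬h) → ¬h (rename-transport eq φ h)
    where
    eq : ∀ j a → τ j (projectVar V a) ≡ τ j (embedVar a)
    eq j (inj₁ i) = refl
    eq j (inj₂ w) with w ∈? V
    ... | yes _   = refl
    ... | no  w∉V = sym (¬Differs⇒agree τ w w∉V (λ d → none (w , d)) j)

  -- β is, up to equivalence, the disjunction of the ◇ (z ⟷ ~ z′) with z ∈ B.
  record Binds (β : Formula (Var′ I n)) (B : Subset n) : Set where
    field rejects : ∀ τ → τ ⊭ β ⇔ (∀ {z} → z ∈ B → Agree τ z)

  open Binds

  binds-𝐅 : Binds 𝐅 ⊥
  binds-𝐅 .rejects τ = mk⇔ (λ _ {_} z∈⊥ → contradiction z∈⊥ ∉⊥) (λ _ ())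

  binds-addBind : ∀ {β B} z → Binds β B → Binds (addBind β z) (B ∪ ⁅ z ⁆)
  binds-addBind {β} {B} z binds .rejects τ = mk⇔ agree reject
    where
    ◇z = ◇ (var (out z) ⟷ ~ var (out′ z))

    agree : τ ⊭ addBind β z → ∀ {y} → y ∈ B ∪ ⁅ z ⁆ → Agree τ y
    agree ¬β y∈ with x∈p∪q⁻ B ⁅ z ⁆ y∈
    ... | inj₁ y∈B = to (binds .rejects τ) (⊭-∨⁻ˡ β ◇z ¬β) y∈B
    ... | inj₂ y∈⁅z⁆ with refl ← x∈⁅y⁆⇒x≡y z y∈⁅z⁆ = ⊭◇⇒agree τ z (⊭-∨⁻ʳ β ◇z ¬β)

    reject : (∀ {y} → y ∈ B ∪ ⁅ z ⁆ → Agree τ y) → τ ⊭ addBind β z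
    reject h = ⊭-∨⁺ β ◇z
      (from (binds .rejects τ) (h ∘ p⊆p∪q ⁅ z ⁆))
      (agree⇒⊭◇ τ z (h (q⊆p∪q B ⁅ z ⁆ (x∈⁅x⁆ z))))

  -- The invariant of an iteration and minimality

  module _ (φ : Formula (Var I n)) where

    parsed∈independent :
      ∀ {V W β B τ z} → Independent φ W → V ⊆ W → Binds β B →
      τ ⊭ β ∨ independence φ V → Valid (addBind β z ∨ independence φ V) → z ∈ W
    parsed∈independent {V} {W} {β} {B} {τ} {z} indep V⊆W binds ¬τ valid =
      decidable-stable (z ∈? W) λ z∉W →
      ⊭-∨⁻ʳ β (independence φ V) ¬τ λ ((h , h∁) , ¬h) →
      -- Mixing along `W` gives s on `V`, t on the rest of `W` and s off `W`, which is how `ρ` reads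
      -- under projection to `V`.
      independent-mix φ indep (project⇒pick φ h) (project-∁⇒pick φ h∁) λ m →
      valid ρ
        ( from (binds-addBind z binds .rejects ρ) (agree z∉W)
        , λ k → k
          ( ( pick⇒project φ (pick-[,]⁺ φ (pick-cong φ eq m))
            -- No mixing here: `ρ` keeps s everywhere and t on `V`, since `V ⊆ W`.
            , pick⇒project-∁ φ (pick-[,]⁺ φ (pick-cong φ eq∁ (project-∁⇒pick φ h∁))) )
          , ¬h ∘ pick⇒embed φ ∘ pick-[,]⁻ φ ∘ embed⇒pick φ ) )
      where
      ρ : Trace (Var′ I n)
      ρ = τ [ const true , not ∘ χ W ]

      eq : ∀ w → (if χ W w then χ V w else not (χ V w)) ≡ (if χ V w then true else not (χ W w))
      eq w with w ∈? V | w ∈? W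
      ... | yes _   | yes _   = refl
      ... | yes w∈V | no  w∉W = contradiction (V⊆W w∈V) w∉W
      ... | no  _   | yes _   = refl
      ... | no  _   | no  _   = refl

      eq∁ : ∀ w → not (χ V w) ≡ (if not (χ V w) then true else not (χ W w))
      eq∁ w with w ∈? V | w ∈? W
      ... | yes _   | yes _   = refl
      ... | yes w∈V | no  w∉W = contradiction (V⊆W w∈V) w∉W
      ... | no  _   | _       = refl

      agree-ρ : ∀ {y} → Agree τ y → Agree ρ y
      agree-ρ {y} h i with χ W y
      ... | true  = h i
      ... | false = refl

      agree : z ∉ W → ∀ {y} → y ∈ B ∪ ⁅ z ⁆ → Agree ρ y
      agree z∉W y∈ with x∈p∪q⁻ B ⁅ z ⁆ y∈
      ... | inj₁ y∈B = agree-ρ (to (binds .rejects τ) (⊭-∨⁻ˡ β (independence φ V) ¬τ) y∈B)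
      ... | inj₂ y∈⁅z⁆ with refl ← x∈⁅y⁆⇒x≡y z y∈⁅z⁆ =
        λ i → cong (λ b → τ i (copy (not b) z)) (sym (dec-false (z ∈? W) z∉W))

    -- The witness is the variable with which the iteration started. Once `V` is independent, this
    -- makes it the least independent set containing that variable.
    Necessary : Subset n → Set
    Necessary V = ∃[ x ] x ∈ V × (∀ {W} → Independent φ W → x ∈ W → V ⊆ W)

    Invariant : State I n → Set
    Invariant (start R)     = Nonempty R
    Invariant (refine V)    = Necessary V
    Invariant (parse V β τ) = Necessary V × (∃[ B ] Binds β B) × τ ⊭ β ∨ independence φ V
    Invariant (computed V)  = Necessary V × Independent φ V

    step-invariant : ∀ {s s′} → Step φ s s′ → Invariant s → Invariant s′
    step-invariant (choose {x = x} _) _ = x , x∈⁅x⁆ x , λ {W} _ x∈W y∈⁅x⁆ →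
      subst (_∈ W) (sym (x∈⁅y⁆⇒x≡y x y∈⁅x⁆)) x∈W
    step-invariant (inner-passed (passed valid)) necessary = necessary , valid
    step-invariant (inner-failed {V} (failed ¬σ)) necessary =
      necessary , (⊥ , binds-𝐅) , ⊭-∨⁺ 𝐅 (independence φ V) id ¬σ
    step-invariant (parse-passed {V} {z = z} _ (passed valid))
                   ((x , x∈V , least) , (B , binds) , ¬τ) =
      x , p⊆p∪q ⁅ z ⁆ x∈V , λ {W} indep x∈W y∈ →
        [ least indep x∈W
        , (λ y∈⁅z⁆ → subst (_∈ W) (sym (x∈⁅y⁆⇒x≡y z y∈⁅z⁆))
                       (parsed∈independent indep (least indep x∈W) binds ¬τ valid))
        ]′ (x∈p∪q⁻ V ⁅ z ⁆ y∈)
    step-invariant (parse-failed {z = z} _ (failed ¬τ′)) (necessary , (B , binds) , _) =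
      necessary , (B ∪ ⁅ z ⁆ , binds-addBind z binds) , ¬τ′

    steps-invariant : ∀ {s s′} → Steps φ s s′ → Invariant s → Invariant s′
    steps-invariant ε              = id
    steps-invariant (step ◅ steps) = steps-invariant steps ∘ step-invariant step

    necessary⇒minimal : ∀ {V} → Necessary V → Independent φ V → Minimal φ V
    necessary⇒minimal {V} (x , x∈V , least) indepV
                      (U , (u , u∈U) , (U⊆V , v , v∈V , v∉U) , indepU) with x ∈? U
    ... | yes x∈U = v∉U (least indepU x∈U v∈V)
    -- The independent set `V ∩ ∁ U` contains `x`, so it includes `V`, and `u` would lie off `U`.
    ... | no  x∉U = x∈p⇒x∉∁p u∈U (proj₂ (x∈p∩q⁻ V (∁ U) (V⊆V∖U (U⊆V u∈U))))
      where
      V⊆V∖U : V ⊆ V ∩ ∁ U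
      V⊆V∖U = least (independent-∩ φ indepV (independent-∁ φ indepU))
                    (x∈p∩q⁺ (x∈V , x∉p⇒x∈∁p x∉U))

    -- Progress and termination

    normal⇒computed : ∀ s → Invariant s → IsNormalForm (Step φ) s → ∃[ V ] s ≡ computed V
    normal⇒computed (start R) (x , x∈R) normal = ⊥-elim (normal (_ , choose x∈R))
    normal⇒computed (refine V) _ normal = ⊥-elim (¬¬CheckValidity-~ _ λ
      { _ c@(passed _) → normal (_ , inner-passed c)
      ; _ c@(failed _) → normal (_ , inner-failed c) })
    normal⇒computed (parse V β τ) (_ , _ , ¬τ) normal =
      -- A choice of `z` and an answer of the checker exist up to double negation, which suffices
      -- for a contradiction.
      ⊥-elim (¬¬∃Differs φ (⊭-∨⁻ʳ β (independence φ V) ¬τ) λ (z , differs) →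
      ¬¬CheckValidity-~ _ λ
      { _ c@(passed _) → normal (_ , parse-passed {z = z} differs c)
      ; _ c@(failed _) → normal (_ , parse-failed {z = z} differs c) })
    normal⇒computed (computed V) _ _ = V , refl

    -- Each failed check enlarges `B`: `τ` agrees on all of `B`, whereas the chosen `z` differs. A
    -- passed check enlarges `V`, which is left to the outer induction.
    parse-terminates : ∀ {V B β τ} → (∀ {V′} → V ⊂ V′ → Terminates φ (refine V′)) →
                       Acc _⊃_ B → Binds β B → τ ⊭ β → Terminates φ (parse V β τ)
    parse-terminates {V} {β = β} {τ} larger (acc rs) binds ¬τ = acc λ
      { (parse-passed (z∈∁V , _) _) → larger (p⊂p∪⁅x⁆ (x∈∁p⇒x∉p z∈∁V))
      ; (parse-failed {z = z} differs (failed ¬τ′)) →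
          parse-terminates larger
            (rs (p⊂p∪⁅x⁆ λ z∈B → agree⇒¬Differs τ z (to (binds .rejects τ) ¬τ z∈B) differs))
            (binds-addBind z binds)
            (⊭-∨⁻ˡ (addBind β z) (independence φ V) ¬τ′) }

    refine-terminates : ∀ {V} → Acc _⊃_ V → Terminates φ (refine V)
    refine-terminates (acc rs) = acc λ
      { (inner-passed _) → acc λ ()
      ; (inner-failed _) →
          parse-terminates (λ V⊂V′ → refine-terminates (rs V⊂V′)) (⊃-wellFounded ⊥) binds-𝐅 id }

    start-terminates : ∀ {R} → Terminates φ (start R)
    start-terminates = acc λ { (choose _) → refine-terminates (⊃-wellFounded _) }

theorem1 : {I : Set} {n : ℕ} (φ : Formula (Var I n)) → Satisfiable φ →
    (clusters : List (Subset n)) (R : Subset n) →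
    LoopHead φ clusters R → Nonempty R →
    -- the iteration terminates,
    Terminates φ (start R) ×
    -- can only come to a halt by computing a set,
    (∀ s → Steps φ (start R) s → IsNormalForm (Step φ) s → ∃[ V ] s ≡ computed V) ×
    -- and every set it may compute is independent and minimal
    (∀ V → Steps φ (start R) (computed V) → Independent φ V × Minimal φ V)
theorem1 φ _ _ R _ nonempty =
  start-terminates φ ,
  (λ s steps → normal⇒computed φ s (steps-invariant φ steps nonempty)) ,
  λ V steps → let necessary , indep = steps-invariant φ steps nonempty in
    indep , necessary⇒minimal φ necessary indep
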